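{- Let $D$ be a finite simple digraph that consists of $k$ components where $k\ge 1$, and let $D_i$ denote the $i$-th component of $D$, $1\le i\le k$. Then $$F(D)=\max_{1\le j\le k}\left(F(D_j)+\sum_{i=1,\,i\ne j}^{k}|V(D_i)|\right).$$
   Context: A finite simple digraph $D=(V,A)$ has finite nonempty vertex set $V$ and arc set $A$ consisting of ordered pairs of distinct vertices (no loops, no parallel arcs; both $(u,v)$ and $(v,u)$ may be present). $N_D^+(v)=\{u:(v,u)\in A\}$. The components of $D$ are its weakly connected components, i.e. the subdigraphs induced by the vertex sets of the connected components of the underlying undirected graph. Zero forcing: for $S\subseteq V$ let $B^0(S)=S$ and $B^{i+1}(S)=B^i(S)\cup\{w:\{w\}=N_D^+(v)\setminus B^i(S)\text{ for some }v\in B^i(S)\}$. $S$ is a zero forcing set (ZFS) if $B^t(S)=V$ for some $t\ge 0$, and a failed zero forcing set (FZFS) otherwise. The failed zero forcing number $F(D)$ is the largest cardinality of an FZFS of $D$. -}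

module Defs where

open import Data.Bool.Properties as Bool using ()
open import Data.Empty using (⊥-elim)
open import Data.Fin using (Fin; zero; suc)
open import Data.Fin.Properties as Fin using (any?)
open import Data.Fin.Subset
  using (Subset; _∈_; _⊆_; _⊂_; _∪_; _─_; ⁅_⁆; ∣_∣; Nonempty) renaming (⊥ to ∅)
open import Data.Fin.Subset.Properties
  using (_∈?_; _⊆?_; _⊂?_; p⊆p∪q; ⊆-antisym; p⊂q⇒∣p∣<∣q∣; ∣p∣≤n; ∉⊥; ⊥⊆; ∪-idem;
         anySubset?)
open import Data.List using (allFin; filter; map)
open import Data.List.Extrema.Nat using (max)
open import Data.Nat using (ℕ; zero; suc; _≤_; _<_; _+_; _∸_; z≤n; s≤s)
open import Data.Nat.ListAction using (sum)
open import Data.Nat.Properties as ℕ using (anyUpTo?)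
open import Data.Product using (∃; _×_; _,_; proj₁; proj₂)
open import Data.Sum using (_⊎_; inj₁; inj₂)
open import Data.Vec using (tabulate; _∷_)
open import Data.Vec.Properties using (≡-dec)
open import Function using (_∘_; _⇔_; Equivalence)
open import Level using (0ℓ)
open import Relation.Binary using (Rel)
import Relation.Binary as Binary
open import Relation.Binary.Construct.Closure.Equivalence using (EqClosure)
open import Relation.Binary.Construct.Closure.ReflexiveTransitive using (ε; _◅_)
open import Relation.Binary.Construct.Closure.Symmetric using (fwd; bwd)
open import Relation.Binary.PropositionalEquality
  using (_≡_; refl; sym; trans; cong; subst)
open import Relation.Nullary using (¬_; Dec; yes; no; does; contradiction)
open import Relation.Nullary.Decidable using (_×-dec_; ¬?)
open import Relation.Unary using (Pred)
import Relation.Unary as Unary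

-- The vertices form a subset of an ambient finite type, so that the vertex set
-- of a subdigraph is a subset of the same type.
record Digraph (n : ℕ) : Set₁ where
  field
    V        : Subset n
    nonempty : Nonempty V
    Arc      : Rel (Fin n) 0ℓ
    Arc?     : Binary.Decidable Arc
    source∈V : ∀ {u v} → Arc u v → u ∈ V
    target∈V : ∀ {u v} → Arc u v → v ∈ V
    loopless : ∀ {v} → ¬ Arc v v

open Digraph public

-- Set-builder notation for a decidable predicate.
⟦_⟧ : ∀ {n} {P : Pred (Fin n) 0ℓ} → Unary.Decidable P → Subset n
⟦ P? ⟧ = tabulate (does ∘ P?)

module _ {n : ℕ} (D : Digraph n) where

  N⁺ : Fin n → Subset n
  N⁺ v = ⟦ Arc? D v ⟧

  Forced : Subset n → Pred (Fin n) 0ℓ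
  Forced S w = ∃ λ v → v ∈ S × ⁅ w ⁆ ≡ N⁺ v ─ S

  Forced? : ∀ S → Unary.Decidable (Forced S)
  Forced? S w = any? λ v → (v ∈? S) ×-dec ≡-dec Bool._≟_ ⁅ w ⁆ (N⁺ v ─ S)

  B : ℕ → Subset n → Subset n
  B zero    S = S
  B (suc i) S = B i S ∪ ⟦ Forced? (B i S) ⟧

  ZFS : Pred (Subset n) 0ℓ
  ZFS S = S ⊆ V D × ∃ λ t → B t S ≡ V D

  FZFS : Pred (Subset n) 0ℓ
  FZFS S = S ⊆ V D × ¬ ZFS S

  IsLargestFZFSSize : Pred ℕ 0ℓ
  IsLargestFZFSSize m =
    (∃ λ S → FZFS S × ∣ S ∣ ≡ m) × (∀ S → FZFS S → ∣ S ∣ ≤ m)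

  -- The closure process stabilises, so being a (failed) zero forcing set is
  -- decidable; ∅ is always failed, so a largest failed set exists.

  stable-or-grows : ∀ S i → B (suc i) S ≡ B i S ⊎ ∣ B i S ∣ < ∣ B (suc i) S ∣
  stable-or-grows S i with B i S ⊂? B (suc i) S
  ... | yes p = inj₂ (p⊂q⇒∣p∣<∣q∣ p)
  ... | no ¬p = inj₁ (⊆-antisym back (p⊆p∪q _))
    where
    back : B (suc i) S ⊆ B i S
    back {x} x∈ with x ∈? B i S
    ... | yes y = y
    ... | no ¬y = ⊥-elim (¬p (p⊆p∪q _ , x , x∈ , ¬y))

  search : ∀ S k → (∃ λ i → B (suc i) S ≡ B i S) ⊎ k ≤ ∣ B k S ∣
  search S zero = inj₂ z≤n
  search S (suc k) with search S k | stable-or-grows S k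
  ... | inj₁ s | _      = inj₁ s
  ... | inj₂ _ | inj₁ e = inj₁ (k , e)
  ... | inj₂ p | inj₂ q = inj₂ (ℕ.≤-trans (s≤s p) q)

  stabilises : ∀ S → ∃ λ i → B (suc i) S ≡ B i S
  stabilises S with search S (suc n)
  ... | inj₁ s = s
  ... | inj₂ p = contradiction (ℕ.≤-trans p (∣p∣≤n (B (suc n) S))) ℕ.1+n≰n

  stays : ∀ S i → B (suc i) S ≡ B i S → ∀ j → B (j + i) S ≡ B i S
  stays S i e zero    = refl
  stays S i e (suc j) =
    trans (cong (λ T → T ∪ ⟦ Forced? T ⟧) (stays S i e j)) e

  ZFS? : Unary.Decidable ZFS
  ZFS? S = (S ⊆? V D) ×-dec reaches?
    where
    i = proj₁ (stabilises S)

    bounded : ∀ t → B t S ≡ V D → ∃ λ t′ → t′ < suc i × B t′ S ≡ V D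
    bounded t e with ℕ.≤-total t i
    ... | inj₁ t≤i = t , s≤s t≤i , e
    ... | inj₂ i≤t = i , ℕ.≤-refl ,
      trans (sym (stays S i (proj₂ (stabilises S)) (t ∸ i)))
            (trans (cong (λ s → B s S) (ℕ.m∸n+n≡m i≤t)) e)

    reaches? : Dec (∃ λ t → B t S ≡ V D)
    reaches? with anyUpTo? (λ t → ≡-dec Bool._≟_ (B t S) (V D)) (suc i)
    ... | yes (t , _ , e) = yes (t , e)
    ... | no ¬p           = no λ (t , e) → ¬p (bounded t e)

  FZFS? : Unary.Decidable FZFS
  FZFS? S = (S ⊆? V D) ×-dec ¬? (ZFS? S)

  B-∅ : ∀ t {x} → ¬ (x ∈ B t ∅)
  B-∅ t = ∉⊥ ∘ subst (_ ∈_) (B≡∅ t)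
    where
    ⟦⟧≡∅ : ∀ {m} {P : Pred (Fin m) 0ℓ} (P? : Unary.Decidable P) →
           (∀ x → ¬ P x) → ⟦ P? ⟧ ≡ ∅
    ⟦⟧≡∅ {zero}  P? ¬P = refl
    ⟦⟧≡∅ {suc m} P? ¬P with P? zero
    ... | yes p = contradiction p (¬P _)
    ... | no  _ = cong (_ ∷_) (⟦⟧≡∅ (P? ∘ suc) (¬P ∘ suc))

    B≡∅ : ∀ t → B t ∅ ≡ ∅
    B≡∅ zero    = refl
    B≡∅ (suc t) rewrite B≡∅ t
      | ⟦⟧≡∅ (Forced? ∅) (λ _ (_ , v∈∅ , _) → ∉⊥ v∈∅)
      = ∪-idem ∅

  ∅-failed : FZFS ∅
  ∅-failed = ⊥⊆ , λ (_ , t , e) →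
    B-∅ t (subst (proj₁ (nonempty D) ∈_) (sym e) (proj₂ (nonempty D)))

  largest : ∀ m → (∀ S → FZFS S → ∣ S ∣ ≤ m) → ∃ IsLargestFZFSSize
  largest m bound with anySubset? (λ S → FZFS? S ×-dec (∣ S ∣ ℕ.≟ m))
  ... | yes p = m , p , bound
  largest zero bound | no ¬p =
    contradiction (∅ , ∅-failed , ℕ.n≤0⇒n≡0 (bound ∅ ∅-failed)) ¬p
  largest (suc m) bound | no ¬p =
    largest m λ S f → ℕ.≤-pred (ℕ.≤∧≢⇒< (bound S f) (λ e → ¬p (S , f , e)))

  largestFZFSSize : ∃ IsLargestFZFSSize
  largestFZFSSize = largest n (λ S _ → ∣p∣≤n S)

  F : ℕ
  F = proj₁ largestFZFSSize

  Connected : Rel (Fin n) 0ℓ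
  Connected = EqClosure (Arc D)

  IsComponent : Pred (Subset n) 0ℓ
  IsComponent W = ∃ λ v → v ∈ V D × (∀ u → u ∈ W ⇔ Connected v u)

  induced : (W : Subset n) → Nonempty W → W ⊆ V D → Digraph n
  induced W W≢∅ _ = record
    { V        = W
    ; nonempty = W≢∅
    ; Arc      = λ u v → Arc D u v × u ∈ W × v ∈ W
    ; Arc?     = λ u v → Arc? D u v ×-dec ((u ∈? W) ×-dec (v ∈? W))
    ; source∈V = proj₁ ∘ proj₂
    ; target∈V = proj₂ ∘ proj₂
    ; loopless = loopless D ∘ proj₁
    }

  -- The components of D are listed, without repetition, as the k sets
  -- vertexSet i.
  record Components (k : ℕ) : Set where
    field
      vertexSet   : Fin k → Subset n
      isComponent : ∀ i → IsComponent (vertexSet i)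
      distinct    : ∀ {i j} → vertexSet i ≡ vertexSet j → i ≡ j
      exhaustive  : ∀ W → IsComponent W → ∃ λ i → vertexSet i ≡ W

  component-nonempty : ∀ {W} → IsComponent W → Nonempty W
  component-nonempty (v , _ , W⇔) = v , Equivalence.from (W⇔ v) ε

  connected-in-V : ∀ {u v} → u ∈ V D → Connected u v → v ∈ V D
  connected-in-V u∈V ε           = u∈V
  connected-in-V _   (fwd a ◅ c) = connected-in-V (target∈V D a) c
  connected-in-V _   (bwd a ◅ c) = connected-in-V (source∈V D a) c

  component-⊆V : ∀ {W} → IsComponent W → W ⊆ V D
  component-⊆V (_ , v∈V , W⇔) {u} u∈W =
    connected-in-V v∈V (Equivalence.to (W⇔ u) u∈W)

  component : ∀ {k} → Components k → Fin k → Digraph n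
  component C i = induced (vertexSet i) (component-nonempty (isComponent i))
                                        (component-⊆V (isComponent i))
    where open Components C

-- The default 0 matters only for k = 0.
maxOver : ∀ {k} → (Fin k → ℕ) → ℕ
maxOver {k} f = max 0 (map f (allFin k))

sumExcept : ∀ {k} → Fin k → (Fin k → ℕ) → ℕ
sumExcept {k} j f = sum (map f (filter (λ i → ¬? (i Fin.≟ j)) (allFin k)))

{-# OPTIONS --safe #-}
module Submission where

-- A component is closed under arcs in both directions, so forcing in D
-- restricts, step by step, to forcing in each component.  Hence S fails in D
-- exactly if S ∩ V(Dⱼ) fails in Dⱼ for some j, and for fixed j the largest
-- such S is a largest failed set of Dⱼ together with all other components.

open import Defs
open import Data.Fin using (Fin)
open import Data.Fin.Properties as Fin using (any?; ¬∀⟶∃¬; sequence)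
open import Data.Fin.Subset
  using (Subset; inside; outside; _∈_; _∉_; _⊆_; _∪_; _∩_; _─_; ⋃; ∣_∣; Nonempty)
open import Data.Fin.Subset.Properties
  using (_∈?_; ∉⊥; ∣⊥∣≡0; ⊆-refl; ⊆-trans; ⊆-antisym; x∈⁅x⁆; p⊆q⇒∣p∣≤∣q∣;
         p⊆p∪q; q⊆p∪q; x∈p∪q⁻; p∩q⊆p; p∩q⊆q; x∈p∩q⁺; x∈p∩q⁻; ∩-distribʳ-∪;
         p─q⊆p; x∈p∧x∉q⇒x∈p─q)
open import Data.List using (List; []; _∷_; allFin; filter; map)
open import Data.List.Extrema.Nat using (xs≤max; max≤v⁺)
open import Data.List.Membership.Propositional using () renaming (_∈_ to _∈ˡ_)
open import Data.List.Membership.Propositional.Properties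
  using (∈-allFin; ∈-filter⁺; ∈-filter⁻)
open import Data.List.Relation.Unary.All as All using ([]; _∷_)
open import Data.List.Relation.Unary.All.Properties as All using ()
open import Data.List.Relation.Unary.AllPairs using ([]; _∷_)
open import Data.List.Relation.Unary.Any using (here; there)
open import Data.List.Relation.Unary.Unique.Propositional using (Unique)
import Data.List.Relation.Unary.Unique.Propositional.Properties as Unique
open import Data.Nat using (ℕ; zero; suc; _+_; _≤_; z≤n)
open import Data.Nat.ListAction using (sum)
open import Data.Nat.Properties as ℕ using ()
open import Data.Product using (∃; _×_; _,_; proj₁; proj₂)
open import Data.Sum using (inj₁; inj₂; [_,_]′)
open import Data.Vec using ([]; _∷_; here; there)
open import Data.Vec.Properties using (lookup∘tabulate; lookup⇒[]=; []=⇒lookup)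
open import Effect.Monad using (RawMonad)
open import Function using (_∘_; _⇔_; mk⇔; Equivalence)
open import Level using (0ℓ)
open import Relation.Binary.Construct.Closure.Equivalence as EqClosure using ()
open import Relation.Binary.Construct.Closure.ReflexiveTransitive using (ε; _◅◅_)
open import Relation.Binary.PropositionalEquality
  using (_≡_; refl; sym; trans; cong; subst)
open import Relation.Nullary using (yes; no; contradiction)
open import Relation.Nullary.Decidable
  using (dec-true; decidable-stable; ¬?; ¬¬-excluded-middle)
open import Relation.Nullary.Negation using (¬¬-Monad)
open import Relation.Unary using (Pred; Decidable)

private
  variable
    n k : ℕ

-- Finite subsets: membership and cardinality.

module _ {P : Pred (Fin n) 0ℓ} (P? : Decidable P) where

  ∈⟦⟧⁺ : ∀ {x} → P x → x ∈ ⟦ P? ⟧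
  ∈⟦⟧⁺ {x} px = lookup⇒[]= x _ (trans (lookup∘tabulate _ x) (dec-true (P? x) px))

  ∈⟦⟧⁻ : ∀ {x} → x ∈ ⟦ P? ⟧ → P x
  -- Abstracting `P? x` also rewrites the equation beside it, so the `no` case would equate `false`
  -- with `inside` and vanishes.
  ∈⟦⟧⁻ {x} x∈ with P? x | trans (sym (lookup∘tabulate _ x)) ([]=⇒lookup x∈)
  ... | yes px | _ = px

x∈p─q⇒x∉q : ∀ (p q : Subset n) {x} → x ∈ p ─ q → x ∉ q
x∈p─q⇒x∉q (inside  ∷ p) (outside ∷ q) here ()
x∈p─q⇒x∉q (_ ∷ p) (inside  ∷ q) (there x∈) (there x∈q) = x∈p─q⇒x∉q p q x∈ x∈q
x∈p─q⇒x∉q (_ ∷ p) (outside ∷ q) (there x∈) (there x∈q) = x∈p─q⇒x∉q p q x∈ x∈q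

∪-lub : ∀ {p q r : Subset n} → p ⊆ r → q ⊆ r → p ∪ q ⊆ r
∪-lub {p = p} {q} p⊆r q⊆r x∈ = [ (λ x∈p → p⊆r x∈p) , (λ x∈q → q⊆r x∈q) ]′ (x∈p∪q⁻ p q x∈)

p⊆q⇒q∩p≡p : ∀ {p q : Subset n} → p ⊆ q → q ∩ p ≡ p
p⊆q⇒q∩p≡p {p = p} {q} p⊆q = ⊆-antisym (p∩q⊆q q p) (λ x∈p → x∈p∩q⁺ (p⊆q x∈p , x∈p))

∣p∪q∣≡∣p∣+∣q∣ : ∀ (p q : Subset n) → (∀ {x} → x ∈ p → x ∉ q) → ∣ p ∪ q ∣ ≡ ∣ p ∣ + ∣ q ∣
∣p∪q∣≡∣p∣+∣q∣ []            []            _   = refl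
∣p∪q∣≡∣p∣+∣q∣ (inside  ∷ p) (inside  ∷ q) p#q = contradiction here (p#q here)
∣p∪q∣≡∣p∣+∣q∣ (inside  ∷ p) (outside ∷ q) p#q =
  cong suc (∣p∪q∣≡∣p∣+∣q∣ p q λ x∈p x∈q → p#q (there x∈p) (there x∈q))
∣p∪q∣≡∣p∣+∣q∣ (outside ∷ p) (inside  ∷ q) p#q =
  trans (cong suc (∣p∪q∣≡∣p∣+∣q∣ p q λ x∈p x∈q → p#q (there x∈p) (there x∈q)))
        (sym (ℕ.+-suc ∣ p ∣ ∣ q ∣))
∣p∪q∣≡∣p∣+∣q∣ (outside ∷ p) (outside ∷ q) p#q =
  ∣p∪q∣≡∣p∣+∣q∣ p q λ x∈p x∈q → p#q (there x∈p) (there x∈q)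

-- Unions, sums and maxima over finite families.

module _ (W : Fin k → Subset n) where

  ∈-⋃⁺ : ∀ {i is x} → i ∈ˡ is → x ∈ W i → x ∈ ⋃ (map W is)
  ∈-⋃⁺ (here refl) x∈ = p⊆p∪q _ x∈
  ∈-⋃⁺ (there i∈)  x∈ = q⊆p∪q _ _ (∈-⋃⁺ i∈ x∈)

  ∈-⋃⁻ : ∀ is {x} → x ∈ ⋃ (map W is) → ∃ λ i → i ∈ˡ is × x ∈ W i
  ∈-⋃⁻ []       x∈ = contradiction x∈ ∉⊥
  ∈-⋃⁻ (i ∷ is) x∈ with x∈p∪q⁻ (W i) _ x∈
  ... | inj₁ x∈Wi = i , here refl , x∈Wi
  ... | inj₂ x∈⋃  = let j , j∈ , x∈Wj = ∈-⋃⁻ is x∈⋃ in j , there j∈ , x∈Wj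

  -- A point shared by the first set and the union of the rest would, by disjointness, make the
  -- first index reappear later in the list, against uniqueness. So cardinalities add.
  ∣⋃∣≡sum : (∀ {i j x} → x ∈ W i → x ∈ W j → i ≡ j) →
            ∀ {is} → Unique is → ∣ ⋃ (map W is) ∣ ≡ sum (map (∣_∣ ∘ W) is)
  ∣⋃∣≡sum disjoint {[]}     []          = ∣⊥∣≡0 n
  ∣⋃∣≡sum disjoint {i ∷ is} (i∉ ∷ uniq) =
    trans (∣p∪q∣≡∣p∣+∣q∣ (W i) _ λ x∈Wi x∈⋃ →
             let _ , j∈ , x∈Wj = ∈-⋃⁻ is x∈⋃
             in All.lookup i∉ j∈ (disjoint x∈Wi x∈Wj))
          (cong (∣ W i ∣ +_) (∣⋃∣≡sum disjoint uniq))

≤maxOver : ∀ (f : Fin k → ℕ) j → f j ≤ maxOver f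
≤maxOver f j = All.lookup (All.map⁻ (xs≤max 0 (map f (allFin _)))) (∈-allFin j)

maxOver≤ : ∀ (f : Fin k → ℕ) {m} → (∀ j → f j ≤ m) → maxOver f ≤ m
maxOver≤ f f≤m = max≤v⁺ z≤n (All.map⁺ (All.universal f≤m (allFin _)))

-- The forcing process of a single digraph.

module _ (D : Digraph n) where

  B-monotone : ∀ S i j → B D i S ⊆ B D (i + j) S
  B-monotone S i zero rewrite ℕ.+-identityʳ i = ⊆-refl
  B-monotone S i (suc j) rewrite ℕ.+-suc i j =
    ⊆-trans (B-monotone S i j) (p⊆p∪q _)

  B-⊆V : ∀ {S} → S ⊆ V D → ∀ t → B D t S ⊆ V D
  B-⊆V S⊆V zero    = S⊆V
  B-⊆V {S} S⊆V (suc t) = ∪-lub (B-⊆V S⊆V t) forced⊆V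
    where
    forced⊆V : ⟦ Forced? D (B D t S) ⟧ ⊆ V D
    forced⊆V {w} w∈ =
      let v , _ , ⁅w⁆≡ = ∈⟦⟧⁻ (Forced? D (B D t S)) w∈
      in target∈V D (∈⟦⟧⁻ (Arc? D v) (p─q⊆p _ _ (subst (w ∈_) ⁅w⁆≡ (x∈⁅x⁆ w))))

  FZFS-≤F : ∀ {S} → FZFS D S → ∣ S ∣ ≤ F D
  FZFS-≤F = proj₂ (proj₂ (largestFZFSSize D)) _

-- Restriction of forcing to a vertex set closed under arcs.

module _ (D : Digraph n) {W : Subset n} (W≢∅ : Nonempty W) (W⊆V : W ⊆ V D)
         (closed : ∀ {u v} → Arc D u v → u ∈ W ⇔ v ∈ W) where

  private
    D′ : Digraph n
    D′ = induced D W W≢∅ W⊆V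

  -- Every out-neighbour of a vertex of `W` is again in `W`, so passing to `D′` loses no
  -- out-neighbour, and inside `W` the sets `S` and `S ∩ W` agree.
  N⁺-restrict : ∀ S {v} → v ∈ W → N⁺ D v ─ S ≡ N⁺ D′ v ─ (S ∩ W)
  N⁺-restrict S {v} v∈W = ⊆-antisym ⊆₁ ⊆₂
    where
    ⊆₁ : N⁺ D v ─ S ⊆ N⁺ D′ v ─ (S ∩ W)
    ⊆₁ x∈ =
      let a = ∈⟦⟧⁻ (Arc? D v) (p─q⊆p _ _ x∈)
      in x∈p∧x∉q⇒x∈p─q (∈⟦⟧⁺ (Arc? D′ v) (a , v∈W , Equivalence.to (closed a) v∈W))
                       (x∈p─q⇒x∉q _ S x∈ ∘ p∩q⊆p S W)
    ⊆₂ : N⁺ D′ v ─ (S ∩ W) ⊆ N⁺ D v ─ S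
    ⊆₂ x∈ =
      let a , _ , x∈W = ∈⟦⟧⁻ (Arc? D′ v) (p─q⊆p _ _ x∈)
      in x∈p∧x∉q⇒x∈p─q (∈⟦⟧⁺ (Arc? D v) a)
                       (λ x∈S → x∈p─q⇒x∉q _ (S ∩ W) x∈ (x∈p∩q⁺ (x∈S , x∈W)))

  -- The forcing vertex and the forced one are joined by an arc, so `closed` puts both in `W` as
  -- soon as one is there. `N⁺-restrict` then turns a force in `D` into the same force in `D′`, and
  -- back.
  Forced-restrict : ∀ S → ⟦ Forced? D S ⟧ ∩ W ≡ ⟦ Forced? D′ (S ∩ W) ⟧
  Forced-restrict S = ⊆-antisym ⊆₁ ⊆₂
    where
    ⊆₁ : ⟦ Forced? D S ⟧ ∩ W ⊆ ⟦ Forced? D′ (S ∩ W) ⟧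
    ⊆₁ {w} w∈ =
      let w∈F , w∈W      = x∈p∩q⁻ _ W w∈
          v , v∈S , ⁅w⁆≡ = ∈⟦⟧⁻ (Forced? D S) w∈F
          a   = ∈⟦⟧⁻ (Arc? D v) (p─q⊆p _ _ (subst (w ∈_) ⁅w⁆≡ (x∈⁅x⁆ w)))
          v∈W = Equivalence.from (closed a) w∈W
      in ∈⟦⟧⁺ (Forced? D′ (S ∩ W))
           (v , x∈p∩q⁺ (v∈S , v∈W) , trans ⁅w⁆≡ (N⁺-restrict S v∈W))
    ⊆₂ : ⟦ Forced? D′ (S ∩ W) ⟧ ⊆ ⟦ Forced? D S ⟧ ∩ W
    ⊆₂ {w} w∈ =
      let v , v∈ , ⁅w⁆≡ = ∈⟦⟧⁻ (Forced? D′ (S ∩ W)) w∈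
          v∈S , v∈W     = x∈p∩q⁻ S W v∈
          _ , _ , w∈W   = ∈⟦⟧⁻ (Arc? D′ v) (p─q⊆p _ _ (subst (w ∈_) ⁅w⁆≡ (x∈⁅x⁆ w)))
      in x∈p∩q⁺ ( ∈⟦⟧⁺ (Forced? D S) (v , v∈S , trans ⁅w⁆≡ (sym (N⁺-restrict S v∈W)))
                , w∈W)

  B-restrict : ∀ S t → B D t S ∩ W ≡ B D′ t (S ∩ W)
  B-restrict S zero    = refl
  -- The rewrite exposes stage `t` in the form `B D t S ∩ W` to which `Forced-restrict` applies.
  B-restrict S (suc t) rewrite sym (B-restrict S t) =
    trans (∩-distribʳ-∪ W (B D t S) _) (cong (B D t S ∩ W ∪_) (Forced-restrict (B D t S)))

  ZFS-restrict : ∀ {S} → ZFS D S → ZFS D′ (S ∩ W)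
  ZFS-restrict {S} (_ , t , B≡V) = p∩q⊆q S W , t ,
    trans (sym (B-restrict S t)) (trans (cong (_∩ W) B≡V) (p⊆q⇒q∩p≡p W⊆V))

  -- The process in `D′` may fill `W` only at a stage `t` beyond `s`. Both processes are therefore
  -- compared at stage `t + s`, where the one in `D` still equals its stage `s`. Thus a single `s`
  -- serves all components.
  stable-⊇ : ∀ {S s} → B D (suc s) S ≡ B D s S → ZFS D′ (S ∩ W) → W ⊆ B D s S
  stable-⊇ {S} {s} stable (_ , t , B≡W) x∈W =
    subst (_ ∈_) (stays D S s stable t)
      (p∩q⊆p (B D (t + s) S) W
        (subst (_ ∈_) (sym (B-restrict S (t + s)))
          (B-monotone D′ (S ∩ W) t s (subst (_ ∈_) (sym B≡W) x∈W))))

-- Components, and failed sets of the digraph against those of its components.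

module _ (D : Digraph n) (C : Components D k) where

  open Components C

  component-closed : ∀ i {u v} → Arc D u v → u ∈ vertexSet i ⇔ v ∈ vertexSet i
  component-closed i {u} {v} a with isComponent i
  ... | _ , _ , W⇔ = mk⇔
    (λ u∈ → Equivalence.from (W⇔ v) (Equivalence.to (W⇔ u) u∈ ◅◅ u~v))
    (λ v∈ → Equivalence.from (W⇔ u) (Equivalence.to (W⇔ v) v∈ ◅◅ EqClosure.symmetric _ u~v))
    where
    u~v : Connected D u v
    u~v = EqClosure.return a

  -- Through a shared vertex everything in one component is connected to everything in the other, so
  -- the two sets coincide; `distinct` then identifies the indices.
  components-disjoint : ∀ {i j x} → x ∈ vertexSet i → x ∈ vertexSet j → i ≡ j
  components-disjoint {i} {j} x∈i x∈j =
    distinct (⊆-antisym (within i j x∈i x∈j) (within j i x∈j x∈i))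
    where
    within : ∀ i j {x} → x ∈ vertexSet i → x ∈ vertexSet j → vertexSet i ⊆ vertexSet j
    within i j {x} x∈i x∈j {u} u∈i with isComponent i | isComponent j
    ... | _ , _ , i⇔ | _ , _ , j⇔ = Equivalence.from (j⇔ u)
      (Equivalence.to (j⇔ x) x∈j ◅◅
       EqClosure.symmetric _ (Equivalence.to (i⇔ x) x∈i) ◅◅ Equivalence.to (i⇔ u) u∈i)

  -- Connectedness is not assumed decidable, but the goal is decidable, so the
  -- component of x may be formed as a subset under a double negation.
  components-cover : ∀ {x} → x ∈ V D → ∃ λ i → x ∈ vertexSet i
  components-cover {x} x∈V =
    decidable-stable (any? λ i → x ∈? vertexSet i) λ ∄i →
      sequence (RawMonad.rawApplicative ¬¬-Monad)
        (λ u → ¬¬-excluded-middle {A = Connected D x u}) λ conn? →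
          let i , Wi≡ = exhaustive ⟦ conn? ⟧ (x , x∈V , λ u → mk⇔ (∈⟦⟧⁻ conn?) (∈⟦⟧⁺ conn?))
          in ∄i (i , subst (x ∈_) (sym Wi≡) (∈⟦⟧⁺ conn? ε))

  -- If every trace were zero forcing in its component, the stable stage `s` would contain every
  -- component and hence equal `V D`. Since `ZFS?` decides each of the finitely many cases, this
  -- refutation yields an actual failing index.
  FZFS⇒component-FZFS : ∀ {S} → FZFS D S → ∃ λ j → FZFS (component D C j) (S ∩ vertexSet j)
  FZFS⇒component-FZFS {S} (S⊆V , ¬zfs) =
    let j , ¬zfsⱼ = ¬∀⟶∃¬ _ _ (λ i → ZFS? (component D C i) (S ∩ vertexSet i)) λ zfs →
          ¬zfs (S⊆V , s , ⊆-antisym (B-⊆V D S⊆V s) λ x∈V →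
            let i , x∈Wi = components-cover x∈V
            in stable-⊇ D (component-nonempty D (isComponent i)) (component-⊆V D (isComponent i))
                 (component-closed i) {S} {s} stable (zfs i) x∈Wi)
    in j , p∩q⊆q S (vertexSet j) , ¬zfsⱼ
    where
    s      = proj₁ (stabilises D S)
    stable = proj₂ (stabilises D S)

  -- The very list over which `sumExcept j` sums, so that the size of `rest j` becomes that sum.
  others : Fin k → List (Fin k)
  others j = filter (λ i → ¬? (i Fin.≟ j)) (allFin k)

  rest : Fin k → Subset n
  rest j = ⋃ (map vertexSet (others j))

  ∣rest∣ : ∀ j → ∣ rest j ∣ ≡ sumExcept j (∣_∣ ∘ vertexSet)
  ∣rest∣ j = ∣⋃∣≡sum vertexSet components-disjoint
    (Unique.filter⁺ (λ i → ¬? (i Fin.≟ j)) (Unique.allFin⁺ k))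

  rest⊆V : ∀ j → rest j ⊆ V D
  rest⊆V j x∈ = let i , _ , x∈Wi = ∈-⋃⁻ vertexSet (others j) x∈
                in component-⊆V D (isComponent i) x∈Wi

  rest-disjoint : ∀ j {x} → x ∈ vertexSet j → x ∉ rest j
  rest-disjoint j x∈Wj x∈ =
    let i , i∈ , x∈Wi = ∈-⋃⁻ vertexSet (others j) x∈
    in proj₂ (∈-filter⁻ (λ i → ¬? (i Fin.≟ j)) {xs = allFin k} i∈)
             (components-disjoint x∈Wi x∈Wj)

  ∣p∪rest∣ : ∀ j {T} → T ⊆ vertexSet j →
             ∣ T ∪ rest j ∣ ≡ ∣ T ∣ + sumExcept j (∣_∣ ∘ vertexSet)
  ∣p∪rest∣ j {T} T⊆ = trans (∣p∪q∣≡∣p∣+∣q∣ T (rest j) (λ x∈T → rest-disjoint j (T⊆ x∈T)))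
                            (cong (∣ T ∣ +_) (∣rest∣ j))

  -- Serves the upper bound: outside component `j`, a failed set is estimated by all the vertices
  -- there are.
  ⊆∩∪rest : ∀ j {S} → S ⊆ V D → S ⊆ (S ∩ vertexSet j) ∪ rest j
  ⊆∩∪rest j S⊆V x∈S with components-cover (S⊆V x∈S)
  ... | i , x∈Wi with i Fin.≟ j
  ...   | yes refl = p⊆p∪q _ (x∈p∩q⁺ (x∈S , x∈Wi))
  ...   | no  i≢j  = q⊆p∪q _ _
    (∈-⋃⁺ vertexSet (∈-filter⁺ (λ i → ¬? (i Fin.≟ j)) (∈-allFin i) i≢j) x∈Wi)

  -- The trace of `T ∪ rest j` on component `j` is exactly `T`, so if the union forced all of `D`,
  -- then by `ZFS-restrict` `T` would force its component.
  component-FZFS⇒FZFS : ∀ j {T} → FZFS (component D C j) T → FZFS D (T ∪ rest j)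
  component-FZFS⇒FZFS j {T} (T⊆ , ¬zfs) =
    ∪-lub (⊆-trans T⊆ (component-⊆V D (isComponent j))) (rest⊆V j) ,
    λ zfs → ¬zfs (subst (ZFS (component D C j)) ∩≡T
      (ZFS-restrict D (component-nonempty D (isComponent j)) (component-⊆V D (isComponent j))
                    (component-closed j) zfs))
    where
    ∩≡T : (T ∪ rest j) ∩ vertexSet j ≡ T
    ∩≡T = ⊆-antisym
      (λ x∈ → let x∈∪ , x∈Wj = x∈p∩q⁻ _ (vertexSet j) x∈
              in [ (λ x∈T → x∈T) , (λ x∈r → contradiction x∈r (rest-disjoint j x∈Wj)) ]′
                   (x∈p∪q⁻ T _ x∈∪))
      (λ x∈T → x∈p∩q⁺ (p⊆p∪q _ x∈T , T⊆ x∈T))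

theorem4p1 : ∀ {n k : ℕ} (D : Digraph n) → 1 ≤ k → (C : Components D k) →
    F D ≡ maxOver (λ j → F (component D C j) + sumExcept j (λ i → ∣ V (component D C i) ∣))
theorem4p1 {k = k} D _ C = ℕ.≤-antisym upper (maxOver≤ bound lower)
  where
  open Components C

  bound : Fin k → ℕ
  bound j = F (component D C j) + sumExcept j (λ i → ∣ V (component D C i) ∣)

  upper : F D ≤ maxOver bound
  upper =
    let (S , failed , ∣S∣≡F) , _ = proj₂ (largestFZFSSize D)
        j , failedⱼ = FZFS⇒component-FZFS D C failed
        open ℕ.≤-Reasoning
    in begin
      F D                                        ≡⟨ ∣S∣≡F ⟨
      ∣ S ∣                                      ≤⟨ p⊆q⇒∣p∣≤∣q∣ (⊆∩∪rest D C j (proj₁ failed)) ⟩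
      ∣ (S ∩ vertexSet j) ∪ rest D C j ∣         ≡⟨ ∣p∪rest∣ D C j (proj₁ failedⱼ) ⟩
      -- `V (component D C i)` is `vertexSet i` by definition, so this is already the sum in
      -- `bound j`.
      ∣ S ∩ vertexSet j ∣ + sumExcept j (∣_∣ ∘ vertexSet)
        ≤⟨ ℕ.+-monoˡ-≤ _ (FZFS-≤F (component D C j) failedⱼ) ⟩
      bound j                                    ≤⟨ ≤maxOver bound j ⟩
      maxOver bound                              ∎

  lower : ∀ j → bound j ≤ F D
  lower j =
    let (T , failed , ∣T∣≡F) , _ = proj₂ (largestFZFSSize (component D C j))
        open ℕ.≤-Reasoning
    in begin
      bound j                                    ≡⟨ cong (_+ _) ∣T∣≡F ⟨
      ∣ T ∣ + sumExcept j (∣_∣ ∘ vertexSet)      ≡⟨ ∣p∪rest∣ D C j (proj₁ failed) ⟨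
      ∣ T ∪ rest D C j ∣
        ≤⟨ FZFS-≤F D (component-FZFS⇒FZFS D C j failed) ⟩
      F D                                        ∎
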